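{- Let $\delta,\alpha$ be real numbers with $0<\alpha\le\delta\le 1/4$, let $A\subseteq\mathbf{F}_2^n$ with $|A|=\delta N$ where $N=2^n$, and let $\mathcal{R}_\alpha=\{r:|\widehat{A}(r)|\ge\alpha N\}$. Suppose $\Lambda\subseteq\mathbf{F}_2^n$ belongs to the family $\mathbf{\Lambda}(2\log(1/\delta))$. Then for every integer $d$ with $1\le d\le\log(1/\delta)/4$, $$|d\dot{\Lambda}\cap\mathcal{R}_\alpha|\le\Big(\frac{\delta}{\alpha}\Big)^2\Big(\frac{2^{12}\log(1/\delta)}{d}\Big)^d.$$
   Context: $\log$ denotes the logarithm to base $2$. The Fourier transform of $A$ is $\widehat{A}(\xi)=\sum_{x}A(x)e(-\xi\cdot x)$, $e(y)=e^{2\pi i y}$, for $\xi$ in the dual group of $\mathbf{F}_2^n$ (identified with $\mathbf{F}_2^n$, so that $\widehat A(r)=\sum_{x\in A}(-1)^{r\cdot x}$). A set $\Lambda=\{\lambda_1,\dots,\lambda_{|\Lambda|}\}\subseteq\mathbf{F}_2^n$ belongs to the family $\mathbf{\Lambda}(k)$ ($k$ a positive real) if whenever $\sum_i\varepsilon_i\lambda_i=0$ with $\varepsilon_i\in\{ -1,0,1\}$ and $\sum_i|\varepsilon_i|\le k$, all $\varepsilon_i$ are zero. $d\dot{\Lambda}$ denotes the set of all sums of $d$ pairwise distinct elements of $\Lambda$.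
   Formalization: The threshold α is taken to be a rational number rather than a real one; the logarithms are expressed exactly through integer inequalities. -}

module Defs where

open import Data.Bool using (Bool; true; false; if_then_else_; _xor_; _∧_)
open import Data.Nat as ℕ using (ℕ; zero; suc; _^_; _≤_)
import Data.Rational.Properties as ℚP
open import Data.Nat.Properties using (m^n≢0)
open import Data.Integer as ℤ using (ℤ; +_; -[1+_])
open import Data.Fin using (Fin)
open import Data.Fin.Subset using (Subset; ∣_∣; outside; inside)
open import Data.Vec using (Vec; []; _∷_; zipWith; replicate; foldr; lookup)
open import Data.List as List using (List; length)
open import Data.Rational as ℚ using (ℚ; _/_)
open import Data.Product using (Σ; _×_)
open import Relation.Binary.PropositionalEquality using (_≡_)

F2 : ℕ → Set
F2 n = Vec Bool n

𝟎 : ∀ {n} → F2 n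
𝟎 = replicate _ false

_⊕_ : ∀ {n} → F2 n → F2 n → F2 n
_⊕_ = zipWith _xor_

_·_ : ∀ {n} → F2 n → F2 n → Bool
r · x = foldr _ _xor_ false (zipWith _∧_ r x)

sgn : Bool → ℤ
sgn false = + 1
sgn true  = -[1+ 0 ]

-- Â(r) = Σ_{x ∈ A} (-1)^{r·x}   (A given as a duplicate-free list)
fourier : ∀ {n} → List (F2 n) → F2 n → ℤ
fourier A r = List.foldr (λ x s → sgn (r · x) ℤ.+ s) (+ 0) A

data Coef : Set where
  neg zer pos : Coef

absC : Coef → ℕ
absC neg = 1
absC zer = 0
absC pos = 1

-- ε reduced into F₂ (-1 ≡ 1 in characteristic 2)
toF2 : Coef → Bool
toF2 neg = true
toF2 zer = false
toF2 pos = true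

weight : ∀ {m} → Vec Coef m → ℕ
weight = foldr _ (λ e s → absC e ℕ.+ s) 0

combo : ∀ {n m} → Vec Coef m → Vec (F2 n) m → F2 n
combo ε Λ = foldr _ _⊕_ 𝟎 (zipWith (λ e v → if toF2 e then v else 𝟎) ε Λ)

-- Λ = {λ_1,…,λ_m} (enumerated by an injective Vec) belongs to 𝚲(k), where the
-- real bound k is given through the predicate  withinK w  ⟺  w ≤ k.
InFamily : ∀ {n m} → (ℕ → Set) → Vec (F2 n) m → Set
InFamily withinK Λ = ∀ ε → withinK (weight ε) → combo ε Λ ≡ 𝟎 → ∀ i → lookup ε i ≡ zer

subsetSum : ∀ {n m} → Subset m → Vec (F2 n) m → F2 n
subsetSum S Λ = foldr _ _⊕_ 𝟎 (zipWith (λ s v → pick s v) S Λ)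
  where
  pick : ∀ {n} → _ → F2 n → F2 n
  pick outside v = 𝟎
  pick inside  v = v

InDotSum : ∀ {n m} → ℕ → Vec (F2 n) m → F2 n → Set
InDotSum d Λ r = Σ (Subset _) λ S → (∣ S ∣ ≡ d) × (subsetSum S Λ ≡ r)

δ : ∀ {n} → List (F2 n) → ℚ
δ {n} A = (+ length A) / (2 ^ n)
  where instance _ = m^n≢0 2 n

powℚ : ℚ → ℕ → ℚ
powℚ q zero    = ℚ.1ℚ
powℚ q (suc k) = q ℚ.* powℚ q k

-- LogGE A p q  ⟺  p/q ≤ log₂(1/δ) = log₂(N/|A|)  ⟺  2^p · |A|^q ≤ N^q   (q ≥ 1, |A| ≥ 1)
LogGE : ∀ {n} → List (F2 n) → ℕ → ℕ → Set
LogGE {n} A p q = (2 ^ p) ℕ.* (length A ^ q) ≤ (2 ^ n) ^ q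

-- K = (δ/α)² · (2¹²/d)^d, so the claimed bound is K · (log₂(1/δ))^d
boundK : ℚ → (α : ℚ) → .{{_ : ℚ.Positive α}} → (d : ℕ) → 1 ≤ d → ℚ
boundK δ' α d 1≤d = powℚ (δ' ℚ.* ℚ.1/ α) 2 ℚ.* powℚ ((+ (2 ^ 12)) / d) d
  where
  instance _ = ℚP.pos⇒nonZero α
  instance _ = ℕ.>-nonZero 1≤d

{-# OPTIONS --safe #-}
module Submission where

-- Choose signs so that Σ_{r ∈ R} |Â(r)| = Σ_{x ∈ A} F(x) with F = Σ_{r ∈ R} ± (-1)^{r·x}, and bound the
-- right-hand side by Hölder with exponent 2k.  Each r ∈ R is a sum of d elements of Λ, so F is the
-- pullback of a homogeneous polynomial P of degree d on F₂^m along φ : x ↦ (λᵢ·x)ᵢ, and since Λ has no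
-- relation of length ≤ 2kd ≤ 2 log(1/δ), F and P have the same 2k-th moment.  Hypercontractivity on
-- F₂^m bounds that moment by (|R| w^d)^k with w = 1 + 8k.  Taking k to be the largest power of two with
-- kd ≤ log(1/δ) makes the loss δ^(-1/k) at most 4^d, whence |R| ≤ (δ/α)² (36k)^d.

open import Algebra.Bundles using (CommutativeRing)
import Algebra.Properties.CommutativeSemigroup as CommutativeSemigroupProperties
open import Data.Bool using (Bool; true; false; _xor_; _∧_)
import Data.Bool.Properties as BoolP
import Data.Fin as Fin
open import Data.Fin.Subset using (Subset; ∣_∣)
open import Data.Fin.Subset.Properties using (∣⊥∣≡0)
open import Data.Integer as ℤ using (ℤ; +_; -[1+_])
import Data.Integer.Properties as ℤP
open import Data.Integer.Tactic.RingSolver using (solve-∀)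
open import Data.List as List using (List; []; _∷_; length; map; replicate)
import Data.List.Properties as ListP
open import Data.List.Relation.Unary.All as All using (All; []; _∷_)
open import Data.List.Relation.Unary.AllPairs using ([]; _∷_)
open import Data.List.Relation.Unary.Unique.Propositional using (Unique)
import Data.List.Relation.Unary.Unique.Propositional.Properties as UniqueP
open import Data.Nat as ℕ using (ℕ; zero; suc)
import Data.Nat.Properties as ℕP
open import Data.Product using (∃; _×_; _,_)
open import Data.Rational as ℚ using (ℚ)
import Data.Rational.Properties as ℚP
import Data.Rational.Unnormalised as ℚᵘ
import Data.Rational.Unnormalised.Properties as ℚᵘP
open import Data.Sum using (_⊎_; inj₁; inj₂)
open import Data.Vec as Vec using (Vec; []; _∷_; lookup)
import Data.Vec.Properties as VecP
open import Defs
open import Function using (_∘_)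
open import Relation.Binary.PropositionalEquality using (_≡_; _≢_; refl; sym; trans; cong; cong₂; subst; subst₂)
open import Relation.Nullary using (Dec; yes; no; ¬_; contradiction)

-- All analytic estimates are integer inequalities, without roots or norms. Hölder becomes iterated
-- Cauchy-Schwarz, and the concluding k-th root is a repeated comparison of squares; this is why k
-- is a power of two. The usual passage of hypercontractivity from one variable to many goes through
-- Minkowski's inequality. It is avoided by bounding products of k possibly different squared
-- polynomials: splitting off a variable turns such a product into a sum of products of the same
-- kind, so the induction on the dimension closes. The constant 36 combines the loss 4^d with w = 1
-- + 8k ≤ 9k. Since kd ≤ log(1/δ), the factor 36k is at most 36 log(1/δ)/d, well inside the constant
-- 2^12.

module Moments where

  open import Data.Integer using (_+_; _*_; _-_; _^_; _≤_; 0ℤ; 1ℤ)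
  open import Data.Integer.Properties hiding (_≟_)

  -- Order and powers in the integers

  0≤*0≤ : ∀ {x y} → 0ℤ ≤ x → 0ℤ ≤ y → 0ℤ ≤ x * y
  0≤*0≤ {x} {y} p q = subst (_≤ x * y) (*-zeroʳ x) (*-monoˡ-≤-nonNeg x {{ℤ.nonNegative p}} q)

  0≤x² : ∀ x → 0ℤ ≤ x * x
  0≤x² (+ n) = 0≤*0≤ {+ n} {+ n} (ℤ.+≤+ ℕ.z≤n) (ℤ.+≤+ ℕ.z≤n)
  0≤x² -[1+ n ] = ℤ.+≤+ ℕ.z≤n

  *-mono-≤-nonneg : ∀ {a b c d} → 0ℤ ≤ a → 0ℤ ≤ c → a ≤ b → c ≤ d → a * c ≤ b * d
  *-mono-≤-nonneg {a} {b} {c} {d} 0≤a 0≤c a≤b c≤d = ≤-trans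
    (*-monoʳ-≤-nonNeg c {{ℤ.nonNegative 0≤c}} a≤b)
    (*-monoˡ-≤-nonNeg b {{ℤ.nonNegative (≤-trans 0≤a a≤b)}} c≤d)

  *-mono²-≤ : ∀ {c x y} → 0ℤ ≤ c → x ≤ y → c * x ≤ c * y
  *-mono²-≤ {c} 0≤c = *-monoˡ-≤-nonNeg c {{ℤ.nonNegative 0≤c}}

  ≤-from-gap : ∀ {x y z} → y ≡ x + z → 0ℤ ≤ z → x ≤ y
  ≤-from-gap {x} {y} {z} eq 0≤z = subst (x ≤_) (sym eq)
    (subst (_≤ x + z) (+-identityʳ x) (+-monoʳ-≤ x 0≤z))

  x²≤y²⇒x≤y : ∀ {x y} → 0ℤ ≤ y → x * x ≤ y * y → x ≤ y
  x²≤y²⇒x≤y {x} {y} 0≤y p with x ℤ.≤? y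
  ... | yes x≤y = x≤y
  ... | no  x≰y = contradiction p (<⇒≱ (≤-<-trans
          (*-mono²-≤ 0≤y (<⇒≤ y<x))
          (*-monoʳ-<-pos x {{ℤ.positive (≤-<-trans 0≤y y<x)}} y<x)))
    where y<x = ≰⇒> x≰y

  ^-nonneg : ∀ {x} n → 0ℤ ≤ x → 0ℤ ≤ x ^ n
  ^-nonneg zero    _   = ℤ.+≤+ ℕ.z≤n
  ^-nonneg (suc n) 0≤x = 0≤*0≤ 0≤x (^-nonneg n 0≤x)

  ^-mono : ∀ {x y} n → 0ℤ ≤ x → x ≤ y → x ^ n ≤ y ^ n
  ^-mono zero    _   _   = ≤-refl
  ^-mono (suc n) 0≤x x≤y = *-mono-≤-nonneg 0≤x (^-nonneg n 0≤x) x≤y (^-mono n 0≤x x≤y)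

  ^-distrib-* : ∀ x y n → (x * y) ^ n ≡ x ^ n * y ^ n
  ^-distrib-* x y zero    = refl
  ^-distrib-* x y (suc n) = trans (cong (x * y *_) (^-distrib-* x y n)) (rearrange x y (x ^ n) (y ^ n))
    where
    rearrange : ∀ a b c d → a * b * (c * d) ≡ a * c * (b * d)
    rearrange = solve-∀

  -- Sums over lists and over the cube

  listSum : ∀ {X : Set} → (X → ℤ) → List X → ℤ
  listSum f = List.foldr (λ x s → f x + s) 0ℤ

  cubeSum : ∀ {n} → (F2 n → ℤ) → ℤ
  cubeSum {zero}  f = f []
  cubeSum {suc n} f = cubeSum (f ∘ (false ∷_)) + cubeSum (f ∘ (true ∷_))

  interchange : ∀ a b c d → (a + b) + (c + d) ≡ (a + c) + (b + d)
  interchange = solve-∀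

  module _ {X : Set} where

    listSum-cong : ∀ {f g : X → ℤ} → (∀ x → f x ≡ g x) → ∀ xs → listSum f xs ≡ listSum g xs
    listSum-cong f≗g []       = refl
    listSum-cong f≗g (x ∷ xs) = cong₂ _+_ (f≗g x) (listSum-cong f≗g xs)

    listSum-+ : ∀ (f g : X → ℤ) xs → listSum (λ x → f x + g x) xs ≡ listSum f xs + listSum g xs
    listSum-+ f g []       = refl
    listSum-+ f g (x ∷ xs) = trans (cong (λ s → f x + g x + s) (listSum-+ f g xs)) (interchange (f x) (g x) _ _)

    listSum-*ˡ : ∀ c (f : X → ℤ) xs → listSum (λ x → c * f x) xs ≡ c * listSum f xs
    listSum-*ˡ c f []       = sym (*-zeroʳ c)
    listSum-*ˡ c f (x ∷ xs) = trans (cong (λ s → c * f x + s) (listSum-*ˡ c f xs)) (sym (*-distribˡ-+ c (f x) _))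

    listSum-*ʳ : ∀ c (f : X → ℤ) xs → listSum (λ x → f x * c) xs ≡ listSum f xs * c
    listSum-*ʳ c f xs = trans (listSum-cong (λ x → *-comm (f x) c) xs)
      (trans (listSum-*ˡ c f xs) (*-comm c _))

    listSum-zero : ∀ {f : X → ℤ} {xs} → All (λ x → f x ≡ 0ℤ) xs → listSum f xs ≡ 0ℤ
    listSum-zero []         = refl
    listSum-zero (eq ∷ eqs) = cong₂ _+_ eq (listSum-zero eqs)

  listSum-swap : ∀ {X Y : Set} (f : X → Y → ℤ) xs ys →
    listSum (λ x → listSum (f x) ys) xs ≡ listSum (λ y → listSum (λ x → f x y) xs) ys
  listSum-swap f []       ys = sym (listSum-*ˡ 0ℤ (λ _ → 0ℤ) ys)
  listSum-swap f (x ∷ xs) ys = trans (cong (λ s → listSum (f x) ys + s) (listSum-swap f xs ys))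
    (sym (listSum-+ (f x) (λ y → listSum (λ x → f x y) xs) ys))

  cubeSum-cong : ∀ {n} {f g : F2 n → ℤ} → (∀ x → f x ≡ g x) → cubeSum f ≡ cubeSum g
  cubeSum-cong {zero}  f≗g = f≗g []
  cubeSum-cong {suc n} f≗g = cong₂ _+_ (cubeSum-cong (f≗g ∘ (false ∷_))) (cubeSum-cong (f≗g ∘ (true ∷_)))

  cubeSum-mono : ∀ {n} {f g : F2 n → ℤ} → (∀ x → f x ≤ g x) → cubeSum f ≤ cubeSum g
  cubeSum-mono {zero}  f≤g = f≤g []
  cubeSum-mono {suc n} f≤g = +-mono-≤ (cubeSum-mono (f≤g ∘ (false ∷_))) (cubeSum-mono (f≤g ∘ (true ∷_)))

  cubeSum-+ : ∀ {n} (f g : F2 n → ℤ) → cubeSum (λ x → f x + g x) ≡ cubeSum f + cubeSum g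
  cubeSum-+ {zero}  f g = refl
  cubeSum-+ {suc n} f g = trans
    (cong₂ _+_ (cubeSum-+ (f ∘ (false ∷_)) (g ∘ (false ∷_))) (cubeSum-+ (f ∘ (true ∷_)) (g ∘ (true ∷_))))
    (interchange (cubeSum (f ∘ (false ∷_))) _ _ _)

  cubeSum-*ˡ : ∀ {n} c (f : F2 n → ℤ) → cubeSum (λ x → c * f x) ≡ c * cubeSum f
  cubeSum-*ˡ {zero}  c f = refl
  cubeSum-*ˡ {suc n} c f = trans
    (cong₂ _+_ (cubeSum-*ˡ c (f ∘ (false ∷_))) (cubeSum-*ˡ c (f ∘ (true ∷_))))
    (sym (*-distribˡ-+ c _ _))

  cubeSum-0 : ∀ {n} → cubeSum {n} (λ _ → 0ℤ) ≡ 0ℤ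
  cubeSum-0 {n} = cubeSum-*ˡ {n} 0ℤ (λ _ → 0ℤ)

  cubeSum-1 : ∀ {n} → cubeSum {n} (λ _ → 1ℤ) ≡ + (2 ℕ.^ n)
  cubeSum-1 {zero}  = refl
  cubeSum-1 {suc n} = trans (cong₂ _+_ (cubeSum-1 {n}) (cubeSum-1 {n}))
    (cong +_ (cong (2 ℕ.^ n ℕ.+_) (sym (ℕP.+-identityʳ (2 ℕ.^ n)))))

  cubeSum-listSum : ∀ {n} {X : Set} (f : X → F2 n → ℤ) xs →
    cubeSum (λ y → listSum (λ x → f x y) xs) ≡ listSum (λ x → cubeSum (f x)) xs
  cubeSum-listSum {n} f []       = cubeSum-0 {n}
  cubeSum-listSum {n} f (x ∷ xs) = trans (cubeSum-+ (f x) (λ y → listSum (λ x → f x y) xs))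
    (cong (λ s → cubeSum (f x) + s) (cubeSum-listSum f xs))

  -- Characters and multilinear polynomials on the cube

  sgn-xor : ∀ a b → sgn (a xor b) ≡ sgn a * sgn b
  sgn-xor false false = refl
  sgn-xor false true  = refl
  sgn-xor true  false = refl
  sgn-xor true  true  = refl

  -- The indicator of equality, in a recursive form that serves twice: as the coefficient vector of
  -- a single character, and to count how often a point occurs in a list.
  kron : ∀ {n} → F2 n → F2 n → ℤ
  kron []          []          = 1ℤ
  kron (false ∷ x) (false ∷ y) = kron x y
  kron (false ∷ x) (true  ∷ y) = 0ℤ
  kron (true  ∷ x) (false ∷ y) = 0ℤ
  kron (true  ∷ x) (true  ∷ y) = kron x y

  kron-≢ : ∀ {n} {x y : F2 n} → x ≢ y → kron x y ≡ 0ℤ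
  kron-≢ {x = []}        {[]}        x≢y = contradiction refl x≢y
  kron-≢ {x = false ∷ x} {false ∷ y} x≢y = kron-≢ (x≢y ∘ cong (false ∷_))
  kron-≢ {x = false ∷ x} {true  ∷ y} x≢y = refl
  kron-≢ {x = true  ∷ x} {false ∷ y} x≢y = refl
  kron-≢ {x = true  ∷ x} {true  ∷ y} x≢y = kron-≢ (x≢y ∘ cong (true ∷_))

  cubeSum-kron : ∀ {n} x (f : F2 n → ℤ) → cubeSum (λ y → kron x y * f y) ≡ f x
  cubeSum-kron []          f = *-identityˡ (f [])
  cubeSum-kron {suc n} (false ∷ x) f = trans
    (cong₂ _+_ (cubeSum-kron x (f ∘ (false ∷_))) (cubeSum-0 {n})) (+-identityʳ _)
  cubeSum-kron {suc n} (true  ∷ x) f = trans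
    (cong₂ _+_ (cubeSum-0 {n}) (cubeSum-kron x (f ∘ (true ∷_)))) (+-identityˡ _)

  -- The Walsh-Hadamard sum Σ_S c(S) (-1)^{S·x}, organised as a multilinear polynomial in the signs:
  -- the first variable separates the terms that avoid it from those that contain it.
  eval : ∀ {n} → (F2 n → ℤ) → F2 n → ℤ
  eval {zero}  c []      = c []
  eval {suc n} c (b ∷ y) = eval (c ∘ (false ∷_)) y + sgn b * eval (c ∘ (true ∷_)) y

  eval-+ : ∀ {n} (c c′ : F2 n → ℤ) x → eval (λ S → c S + c′ S) x ≡ eval c x + eval c′ x
  eval-+ c c′ []      = refl
  eval-+ c c′ (b ∷ y)
    rewrite eval-+ (c ∘ (false ∷_)) (c′ ∘ (false ∷_)) y | eval-+ (c ∘ (true ∷_)) (c′ ∘ (true ∷_)) y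
    = rearrange (eval (c ∘ (false ∷_)) y) (eval (c′ ∘ (false ∷_)) y) (sgn b) _ _
    where
    rearrange : ∀ p q s u v → (p + q) + s * (u + v) ≡ (p + s * u) + (q + s * v)
    rearrange = solve-∀

  eval-*ˡ : ∀ {n} t (c : F2 n → ℤ) x → eval (λ S → t * c S) x ≡ t * eval c x
  eval-*ˡ t c []      = refl
  eval-*ˡ t c (b ∷ y)
    rewrite eval-*ˡ t (c ∘ (false ∷_)) y | eval-*ˡ t (c ∘ (true ∷_)) y
    = rearrange t _ (sgn b) _
    where
    rearrange : ∀ t p s q → t * p + s * (t * q) ≡ t * (p + s * q)
    rearrange = solve-∀

  eval-0 : ∀ {n} (x : F2 n) → eval (λ _ → 0ℤ) x ≡ 0ℤ
  eval-0 = eval-*ˡ 0ℤ (λ _ → 0ℤ)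

  eval-kron : ∀ {n} (S x : F2 n) → eval (kron S) x ≡ sgn (S · x)
  eval-kron []          []      = refl
  eval-kron (false ∷ S) (b ∷ y) rewrite eval-kron S y | eval-0 y | *-zeroʳ (sgn b) = +-identityʳ _
  eval-kron (true  ∷ S) (b ∷ y) rewrite eval-kron S y | eval-0 y
    = trans (+-identityˡ _) (sym (sgn-xor b (S · y)))

  -- energy w c = Σ_S w^|S| c(S)²
  energy : ∀ {n} → ℤ → (F2 n → ℤ) → ℤ
  energy {zero}  w c = c [] * c []
  energy {suc n} w c = energy w (c ∘ (false ∷_)) + w * energy w (c ∘ (true ∷_))

  energy-cong : ∀ {n} w {c c′ : F2 n → ℤ} → (∀ S → c S ≡ c′ S) → energy w c ≡ energy w c′
  energy-cong {zero}  w eq = cong₂ _*_ (eq []) (eq [])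
  energy-cong {suc n} w eq = cong₂ _+_ (energy-cong w (eq ∘ (false ∷_)))
    (cong (w *_) (energy-cong w (eq ∘ (true ∷_))))

  energy-0 : ∀ {n} w → energy {n} w (λ _ → 0ℤ) ≡ 0ℤ
  energy-0 {zero}  w = refl
  energy-0 {suc n} w rewrite energy-0 {n} w = trans (+-identityˡ _) (*-zeroʳ w)

  -- Changing the single coefficient at S from 0 to t creates no cross term. For a duplicate-free
  -- list of index sets, the coefficients can therefore be added one at a time.
  energy-add : ∀ {n} w t S (c : F2 n → ℤ) → c S ≡ 0ℤ →
    energy w (λ T → t * kron S T + c T) ≡ w ^ ∣ S ∣ * (t * t) + energy w c
  energy-add w t [] c eq rewrite eq = rearrange t
    where
    rearrange : ∀ t → (t * 1ℤ + 0ℤ) * (t * 1ℤ + 0ℤ) ≡ 1ℤ * (t * t) + 0ℤ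
    rearrange = solve-∀
  energy-add w t (false ∷ S) c eq = trans
    (cong₂ (λ a b → a + w * b)
      (energy-add w t S (c ∘ (false ∷_)) eq)
      (energy-cong w (λ T → vanish t (c (true ∷ T)))))
    (+-assoc (w ^ ∣ S ∣ * (t * t)) (energy w (c ∘ (false ∷_))) _)
    where
    vanish : ∀ t z → t * 0ℤ + z ≡ z
    vanish = solve-∀
  energy-add w t (true ∷ S) c eq = trans
    (cong₂ (λ a b → a + w * b)
      (energy-cong w (λ T → vanish t (c (false ∷ T))))
      (energy-add w t S (c ∘ (true ∷_)) eq))
    (rearrange (energy w (c ∘ (false ∷_))) w (w ^ ∣ S ∣) (t * t) _)
    where
    vanish : ∀ t z → t * 0ℤ + z ≡ z
    vanish = solve-∀
    rearrange : ∀ p w u v q → p + w * (u * v + q) ≡ w * u * v + (p + w * q)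
    rearrange = solve-∀

  module Polynomial {n} (σ : F2 n → ℤ) where

    coef : List (F2 n) → F2 n → ℤ
    coef Ss T = listSum (λ S → σ S * kron S T) Ss

    poly : List (F2 n) → F2 n → ℤ
    poly Ss x = listSum (λ S → σ S * sgn (S · x)) Ss

    eval-coef : ∀ Ss x → eval (coef Ss) x ≡ poly Ss x
    eval-coef []       x = eval-0 x
    eval-coef (S ∷ Ss) x = trans (eval-+ (λ T → σ S * kron S T) (coef Ss) x)
      (cong₂ _+_ (trans (eval-*ˡ (σ S) (kron S) x) (cong (σ S *_) (eval-kron S x))) (eval-coef Ss x))

    coef-∉ : ∀ {S Ss} → All (S ≢_) Ss → coef Ss S ≡ 0ℤ
    coef-∉ []           = refl
    coef-∉ (S≢T ∷ S∉Ss) = cong₂ _+_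
      (trans (cong (σ _ *_) (kron-≢ (S≢T ∘ sym))) (*-zeroʳ (σ _)))
      (coef-∉ S∉Ss)

    energy-coef : ∀ {d} w → (∀ S → σ S * σ S ≡ 1ℤ) → ∀ {Ss} → Unique Ss → All (λ S → ∣ S ∣ ≡ d) Ss →
      energy w (coef Ss) ≡ + length Ss * w ^ d
    energy-coef w σ² []         []           = energy-0 {n} w
    energy-coef {d} w σ² {S ∷ Ss} (S∉ ∷ uniq) (refl ∷ sizes) = trans
      (energy-add w (σ S) S (coef Ss) (coef-∉ S∉))
      (trans (cong₂ (λ a b → w ^ ∣ S ∣ * a + b) (σ² S) (energy-coef w σ² uniq sizes))
        (rearrange (w ^ ∣ S ∣) (+ length Ss)))
      where
      rearrange : ∀ u l → u * 1ℤ + l * u ≡ (1ℤ + l) * u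
      rearrange = solve-∀

  prod : ∀ {X : Set} → (X → ℤ) → List X → ℤ
  prod f = List.foldr (λ x p → f x * p) 1ℤ

  prod-nonneg : ∀ {X : Set} {f : X → ℤ} → (∀ x → 0ℤ ≤ f x) → ∀ xs → 0ℤ ≤ prod f xs
  prod-nonneg 0≤f []       = ℤ.+≤+ ℕ.z≤n
  prod-nonneg 0≤f (x ∷ xs) = 0≤*0≤ (0≤f x) (prod-nonneg 0≤f xs)

  prod-replicate : ∀ {X : Set} (f : X → ℤ) k x → prod f (replicate k x) ≡ f x ^ k
  prod-replicate f zero    x = refl
  prod-replicate f (suc k) x = cong (f x *_) (prod-replicate f k x)

  -- Hypercontractivity

  module Hypercontractivity (k : ℕ) (1≤k : 1 ℕ.≤ k) where

    -- `K` is the number of linear factors in a product of k squares. The 4 in `w` comes from the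
    -- cross term in `invariant-step`: its coefficient is at most 2K, and completing the square
    -- costs at most 4K².
    K w : ℤ
    K = + 2 * + k
    w = 1ℤ + + 4 * K

    private
      0<K : 0ℤ ℤ.< K
      0<K = *-monoˡ-<-pos (+ 2) (ℤ.+<+ 1≤k)

    0≤w : 0ℤ ≤ w
    0≤w = +-mono-≤ {0ℤ} {1ℤ} (ℤ.+≤+ ℕ.z≤n) (*-mono²-≤ {+ 4} {0ℤ} (ℤ.+≤+ ℕ.z≤n) (<⇒≤ 0<K))

    -- The slack `f` expresses e < K and makes K a polynomial in e and f, so that the gap between
    -- the two sides is an explicit sum of nonnegative terms. Raising the odd weight from e to 1 + e
    -- leaves exactly one spare (gO)², which absorbs the mixed term gO·hE by completing the square.
    invariant-step : ∀ e f g h E O → 0ℤ ≤ e → 0ℤ ≤ f → 1ℤ + e + f ≡ K →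
      K * ((g * E + h * O) * (g * E + h * O)) + e * ((g * O + h * E) * (g * O + h * E))
        ≤ (g * g + w * (h * h)) * (K * (E * E) + (1ℤ + e) * (O * O))
    invariant-step e f g h E O 0≤e 0≤f K≡ = subst Goal K≡ (≤-from-gap (gap e f g h E O)
      (+-mono-≤ (+-mono-≤ (0≤x² (g * O - (1ℤ + e + f + e) * (h * E)))
        (0≤*0≤ (0≤*0≤ (0≤1+ 0≤f) (+-mono-≤ (0≤1+ (0≤*0≤ (0≤n 3) 0≤L)) 0≤e)) (0≤x² (h * E))))
        (0≤*0≤ (+-mono-≤ (0≤1+ 0≤e) (0≤*0≤ (+-mono-≤ (0≤n 3) (0≤*0≤ (0≤n 4) 0≤e)) 0≤L)) (0≤x² (h * O)))))
      where
      0≤n : ∀ n → 0ℤ ≤ + n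
      0≤n n = ℤ.+≤+ ℕ.z≤n
      0≤1+ : ∀ {x} → 0ℤ ≤ x → 0ℤ ≤ 1ℤ + x
      0≤1+ = +-mono-≤ (0≤n 1)
      0≤L = +-mono-≤ (0≤1+ 0≤e) 0≤f
      Goal : ℤ → Set
      Goal L = L * ((g * E + h * O) * (g * E + h * O)) + e * ((g * O + h * E) * (g * O + h * E))
        ≤ (g * g + (1ℤ + + 4 * L) * (h * h)) * (L * (E * E) + (1ℤ + e) * (O * O))
      gap : ∀ e f g h E O → let L = 1ℤ + e + f in
        (g * g + (1ℤ + + 4 * L) * (h * h)) * (L * (E * E) + (1ℤ + e) * (O * O))
        ≡ (L * ((g * E + h * O) * (g * E + h * O)) + e * ((g * O + h * E) * (g * O + h * E)))
          + ((g * O - (L + e) * (h * E)) * (g * O - (L + e) * (h * E))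
            + (1ℤ + f) * (1ℤ + + 3 * L + e) * ((h * E) * (h * E))
            + (1ℤ + e + (+ 3 + + 4 * e) * L) * ((h * O) * (h * O)))
      gap = solve-∀

    -- The inequality even ≤ Π (g² + w h²) is not inductive, but K even² + e odd² ≤ K Π (g² + w h²)²
    -- is: the weight e of the odd part drops by one for each linear factor, from K down to 0.
    module TwoPoint {X : Set} (g h : X → ℤ) where

      -- The parts of Π (g + σh)² that are even and odd in the sign σ. An entry contributes its
      -- linear factor twice, hence the nested multiplications.
      even odd bound : List X → ℤ
      even []       = 1ℤ
      even (x ∷ xs) = g x * (g x * even xs + h x * odd xs) + h x * (g x * odd xs + h x * even xs)
      odd []       = 0ℤ
      odd (x ∷ xs) = g x * (g x * odd xs + h x * even xs) + h x * (g x * even xs + h x * odd xs)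
      bound = prod (λ x → g x * g x + w * (h x * h x))

      0≤bound : ∀ xs → 0ℤ ≤ bound xs
      0≤bound = prod-nonneg (λ x → +-mono-≤ (0≤x² (g x)) (0≤*0≤ 0≤w (0≤x² (h x))))

      prod-even-odd : ∀ b xs →
        prod (λ x → (g x + sgn b * h x) * (g x + sgn b * h x)) xs ≡ even xs + sgn b * odd xs
      prod-even-odd false []       = refl
      prod-even-odd true  []       = refl
      prod-even-odd false (x ∷ xs) = trans (cong (signed x *_) (prod-even-odd false xs))
        (expand (g x) (h x) (even xs) (odd xs))
        where
        signed = λ x → (g x + sgn false * h x) * (g x + sgn false * h x)
        expand : ∀ g h E O → (g + 1ℤ * h) * (g + 1ℤ * h) * (E + 1ℤ * O)
          ≡ g * (g * E + h * O) + h * (g * O + h * E) + 1ℤ * (g * (g * O + h * E) + h * (g * E + h * O))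
        expand = solve-∀
      prod-even-odd true  (x ∷ xs) = trans (cong (signed x *_) (prod-even-odd true xs))
        (expand (g x) (h x) (even xs) (odd xs))
        where
        signed = λ x → (g x + sgn true * h x) * (g x + sgn true * h x)
        expand : ∀ g h E O → (g + -[1+ 0 ] * h) * (g + -[1+ 0 ] * h) * (E + -[1+ 0 ] * O)
          ≡ g * (g * E + h * O) + h * (g * O + h * E) + -[1+ 0 ] * (g * (g * O + h * E) + h * (g * E + h * O))
        expand = solve-∀

      invariant : ∀ e xs → 0ℤ ≤ e → e + + 2 * + length xs ≡ K →
        K * (even xs * even xs) + e * (odd xs * odd xs) ≤ K * (bound xs * bound xs)
      invariant e []       0≤e eq = ≤-reflexive (base K e)
        where
        base : ∀ K e → K * 1ℤ + e * 0ℤ ≡ K * 1ℤ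
        base = solve-∀
      -- The squared factor of `x` costs two steps, with weights e and 1 + e. The slacks 1 + 2j and
      -- 2j are what the relation between weight and remaining length leaves of K.
      invariant e (x ∷ xs) 0≤e eq = ≤-trans
        (invariant-step e (1ℤ + + 2 * j) (g x) (h x) _ _ 0≤e (+-mono-≤ {0ℤ} {1ℤ} (ℤ.+≤+ ℕ.z≤n) 0≤2j)
          (trans (K₁ e j) eq))
        (subst (b * (K * (E′ * E′) + (1ℤ + e) * (O′ * O′)) ≤_) (collect b K (bound xs))
          (*-mono²-≤ 0≤b (≤-trans
            (invariant-step (1ℤ + e) (+ 2 * j) (g x) (h x) _ _ 0≤1+e 0≤2j (trans (K₂ e j) eq))
            (*-mono²-≤ 0≤b (invariant (1ℤ + (1ℤ + e)) xs (+-mono-≤ {0ℤ} {1ℤ} (ℤ.+≤+ ℕ.z≤n) 0≤1+e)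
              (trans (K₂ e j) eq))))))
        where
        j = + length xs
        b = g x * g x + w * (h x * h x)
        E′ = g x * even xs + h x * odd xs
        O′ = g x * odd xs + h x * even xs
        0≤1+e = +-mono-≤ {0ℤ} {1ℤ} (ℤ.+≤+ ℕ.z≤n) 0≤e
        0≤2j : 0ℤ ≤ + 2 * j
        0≤2j = 0≤*0≤ {+ 2} {j} (ℤ.+≤+ ℕ.z≤n) (ℤ.+≤+ ℕ.z≤n)
        0≤b = +-mono-≤ (0≤x² (g x)) (0≤*0≤ 0≤w (0≤x² (h x)))
        K₁ : ∀ e j → 1ℤ + e + (1ℤ + + 2 * j) ≡ e + + 2 * (1ℤ + j)
        K₁ = solve-∀
        K₂ : ∀ e j → 1ℤ + (1ℤ + e) + + 2 * j ≡ e + + 2 * (1ℤ + j)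
        K₂ = solve-∀
        collect : ∀ b K p → b * (b * (K * (p * p))) ≡ K * ((b * p) * (b * p))
        collect = solve-∀

      -- The odd parts cancel between the two signs. Starting the invariant at weight 0 leaves
      -- K·even² ≤ K·bound², and nonnegativity of `bound` permits comparing without squares.
      two-point : ∀ xs → length xs ≡ k →
        prod (λ x → (g x + sgn false * h x) * (g x + sgn false * h x)) xs
          + prod (λ x → (g x + sgn true * h x) * (g x + sgn true * h x)) xs ≤ + 2 * bound xs
      two-point xs refl = subst (_≤ + 2 * bound xs)
        (sym (trans (cong₂ _+_ (prod-even-odd false xs) (prod-even-odd true xs)) (cancel (even xs) (odd xs))))
        (*-mono²-≤ {+ 2} (ℤ.+≤+ ℕ.z≤n) (x²≤y²⇒x≤y (0≤bound xs)
          (*-cancelˡ-≤-pos _ _ K {{ℤ.positive 0<K}}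
            (subst (_≤ K * (bound xs * bound xs)) (+-identityʳ _)
              (invariant 0ℤ xs ≤-refl (+-identityˡ _))))))
        where
        cancel : ∀ E O → E + 1ℤ * O + (E + -[1+ 0 ] * O) ≡ + 2 * E
        cancel = solve-∀

    moment : ∀ {m} → List (F2 m → ℤ) → F2 m → ℤ
    moment cs x = prod (λ c → eval c x * eval c x) cs

    low high : ∀ {m} → F2 m → (F2 (suc m) → ℤ) → ℤ
    low  y c = eval (c ∘ (false ∷_)) y
    high y c = eval (c ∘ (true  ∷_)) y

    HyperBound : ℕ → Set
    HyperBound m = ∀ (cs : List (F2 m → ℤ)) → length cs ≡ k →
      cubeSum (moment cs) ≤ + (2 ℕ.^ m) * prod (energy w) cs

    -- Here `us` holds polynomials already reduced to m variables and `cs` those still to be split.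
    -- Expanding a factor g² + w h² moves one half of the polynomial into `us`, and the two outcomes
    -- recombine because `energy` obeys the same recursion with the same w. The total length stays
    -- k, so the bound in dimension m applies at the end.
    mixed-moment : ∀ {m} → HyperBound m → ∀ (us : List (F2 m → ℤ)) (cs : List (F2 (suc m) → ℤ)) →
      length us ℕ.+ length cs ≡ k →
      cubeSum (λ y → moment us y * TwoPoint.bound (low y) (high y) cs)
        ≤ + (2 ℕ.^ m) * (prod (energy w) us * prod (energy w) cs)
    mixed-moment {m} hyp us [] len = subst₂ _≤_
      (cubeSum-cong {f = moment us} (λ y → sym (*-identityʳ (moment us y))))
      (cong (+ (2 ℕ.^ m) *_) (sym (*-identityʳ _)))
      (hyp us (trans (sym (ℕP.+-identityʳ _)) len))
    mixed-moment {m} hyp us (c ∷ cs) len = subst₂ _≤_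
      (sym (trans (cubeSum-cong (λ y → split (low y c) (high y c) w (moment us y) (rest y)))
        (trans (cubeSum-+ (branch c₀) (λ y → w * branch c₁ y))
          (cong (λ s → cubeSum (branch c₀) + s) (cubeSum-*ˡ w (branch c₁))))))
      (join (+ (2 ℕ.^ m)) (energy w c₀) (energy w c₁) w (prod (energy w) us) (prod (energy w) cs))
      (+-mono-≤ (mixed-moment hyp (c₀ ∷ us) cs len′)
        (*-mono²-≤ 0≤w (mixed-moment hyp (c₁ ∷ us) cs len′)))
      where
      c₀ = c ∘ (false ∷_)
      c₁ = c ∘ (true ∷_)
      len′ = trans (sym (ℕP.+-suc _ _)) len
      rest : F2 m → ℤ
      rest y = TwoPoint.bound (low y) (high y) cs
      branch : (F2 m → ℤ) → F2 m → ℤ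
      branch u y = (eval u y * eval u y) * moment us y * rest y
      split : ∀ g h w u r → u * ((g * g + w * (h * h)) * r) ≡ g * g * u * r + w * (h * h * u * r)
      split = solve-∀
      join : ∀ p e f w u r → p * (e * u * r) + w * (p * (f * u * r)) ≡ p * (u * ((e + w * f) * r))
      join = solve-∀

    hypercontractive : ∀ m → HyperBound m
    hypercontractive zero    cs len = ≤-reflexive (sym (*-identityˡ _))
    hypercontractive (suc m) cs len = ≤-trans
      (subst (_≤ cubeSum (λ y → + 2 * bound y)) (cubeSum-+ (moment cs ∘ (false ∷_)) (moment cs ∘ (true ∷_)))
        (cubeSum-mono (λ y → TwoPoint.two-point (low y) (high y) cs len)))
      (subst₂ _≤_ (sym (cubeSum-*ˡ (+ 2) bound))
        (trans (sym (*-assoc (+ 2) (+ (2 ℕ.^ m)) _)) (cong (_* prod (energy w) cs) (sym (pos-* 2 (2 ℕ.^ m)))))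
        (*-mono²-≤ {+ 2} (ℤ.+≤+ ℕ.z≤n)
          (subst₂ _≤_ (cubeSum-cong {g = bound} (λ y → *-identityˡ (bound y)))
            (cong (+ (2 ℕ.^ m) *_) (*-identityˡ _))
            (mixed-moment (hypercontractive m) [] cs len))))
      where
      bound : F2 m → ℤ
      bound y = TwoPoint.bound (low y) (high y) cs

  -- Power means

  -- Summing (f x - t)² ≥ 0. With t the head of the list, this controls the cross term in the
  -- inductive step of Cauchy-Schwarz.
  am-gm : ∀ {X : Set} t (f : X → ℤ) xs →
    + 2 * (t * listSum f xs) ≤ listSum (λ x → f x * f x) xs + + length xs * (t * t)
  am-gm t f []       = ≤-reflexive (base t)
    where
    base : ∀ t → + 2 * (t * 0ℤ) ≡ 0ℤ + 0ℤ * (t * t)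
    base = solve-∀
  am-gm t f (x ∷ xs) = ≤-trans
    (≤-from-gap (gap t (f x) (listSum f xs) (listSum (λ x → f x * f x) xs) (+ length xs))
      (0≤x² (f x - t)))
    (≤-trans (+-monoˡ-≤ _ (am-gm t f xs))
      (≤-reflexive (collect (listSum (λ x → f x * f x) xs) (+ length xs) t (f x))))
    where
    gap : ∀ t u s q l → + 2 * (t * s) + (u * u + t * t) ≡ + 2 * (t * (u + s)) + (u - t) * (u - t)
    gap = solve-∀
    collect : ∀ q l t u → q + l * (t * t) + (u * u + t * t) ≡ u * u + q + (1ℤ + l) * (t * t)
    collect = solve-∀

  cauchy-schwarz : ∀ {X : Set} (f : X → ℤ) xs →
    listSum f xs * listSum f xs ≤ + length xs * listSum (λ x → f x * f x) xs
  cauchy-schwarz f []       = ≤-refl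
  cauchy-schwarz f (x ∷ xs) = ≤-trans
    (≤-reflexive (expand (f x) (listSum f xs)))
    (≤-trans (+-mono-≤ (+-mono-≤ (≤-refl {f x * f x}) (am-gm (f x) f xs)) (cauchy-schwarz f xs))
      (≤-reflexive (collect (f x) (listSum (λ x → f x * f x) xs) (+ length xs))))
    where
    expand : ∀ u s → (u + s) * (u + s) ≡ u * u + + 2 * (u * s) + s * s
    expand = solve-∀
    collect : ∀ u q l → u * u + (q + l * (u * u)) + l * q ≡ (1ℤ + l) * (u * u + q)
    collect = solve-∀

  ^2^suc : ∀ x s → x ^ (2 ℕ.^ suc s) ≡ (x * x) ^ (2 ℕ.^ s)
  ^2^suc x s = trans (sym (^-*-assoc x 2 (2 ℕ.^ s))) (cong (λ y → (x * y) ^ (2 ℕ.^ s)) (*-identityʳ x))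

  ^2^suc-split : ∀ x s → x ^ (2 ℕ.^ suc s) ≡ x ^ (2 ℕ.^ s) * x ^ (2 ℕ.^ s)
  ^2^suc-split x s = trans (^2^suc x s) (^-distrib-* x x (2 ℕ.^ s))

  ^2^-cancel-≤ : ∀ {x y} s → 0ℤ ≤ y → x ^ (2 ℕ.^ s) ≤ y ^ (2 ℕ.^ s) → x ≤ y
  ^2^-cancel-≤ {x} {y} zero    0≤y p = subst₂ _≤_ (^-identityʳ x) (^-identityʳ y) p
  ^2^-cancel-≤ {x} {y} (suc s) 0≤y p = x²≤y²⇒x≤y 0≤y
    (^2^-cancel-≤ s (0≤x² y) (subst₂ _≤_ (^2^suc x s) (^2^suc y s) p))

  -- Each doubling of the exponent is one Cauchy-Schwarz, followed by the induction hypothesis for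
  -- f². The extra factor a on the left avoids the exponent 2^s - 1 on the right.
  power-mean : ∀ {X : Set} s (f : X → ℤ) xs → let a = + length xs in
    listSum f xs ^ (2 ℕ.^ s) * a ≤ a ^ (2 ℕ.^ s) * listSum (λ x → f x ^ (2 ℕ.^ s)) xs
  power-mean zero f xs = ≤-reflexive (trans
    (cong (_* + length xs) (*-identityʳ (listSum f xs)))
    (trans (*-comm (listSum f xs) (+ length xs))
      (cong₂ _*_ (sym (*-identityʳ (+ length xs))) (listSum-cong (λ x → sym (*-identityʳ (f x))) xs))))
  power-mean (suc s) f xs = ≤-trans
    (≤-reflexive (cong (_* a) (^2^suc (listSum f xs) s)))
    (≤-trans
      (*-monoʳ-≤-nonNeg a (^-mono n (0≤x² (listSum f xs)) (cauchy-schwarz f xs)))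
      (≤-trans (≤-reflexive (trans (cong (_* a) (^-distrib-* a Q n)) (*-assoc (a ^ n) (Q ^ n) a)))
        (≤-trans (*-mono²-≤ (^-nonneg n (ℤ.+≤+ ℕ.z≤n)) (power-mean s (λ x → f x * f x) xs))
          (≤-reflexive (trans (sym (*-assoc (a ^ n) (a ^ n) _))
            (cong₂ _*_ (sym (^2^suc-split a s)) (listSum-cong (λ x → sym (^2^suc (f x) s)) xs)))))))
    where
    a = + length xs
    n = 2 ℕ.^ s
    Q = listSum (λ x → f x * f x) xs

  kron≤1 : ∀ {n} (x y : F2 n) → kron x y ≤ 1ℤ
  kron≤1 []          []          = ≤-refl
  kron≤1 (false ∷ x) (false ∷ y) = kron≤1 x y
  kron≤1 (false ∷ x) (true  ∷ y) = ℤ.+≤+ ℕ.z≤n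
  kron≤1 (true  ∷ x) (false ∷ y) = ℤ.+≤+ ℕ.z≤n
  kron≤1 (true  ∷ x) (true  ∷ y) = kron≤1 x y

  _≟_ : ∀ {n} (x y : F2 n) → Dec (x ≡ y)
  _≟_ = VecP.≡-dec BoolP._≟_

  multiplicity≤1 : ∀ {n} {xs : List (F2 n)} → Unique xs → ∀ y → listSum (λ x → kron x y) xs ≤ 1ℤ
  multiplicity≤1 []                  y = ℤ.+≤+ ℕ.z≤n
  multiplicity≤1 (_∷_ {x} {xs} x∉xs uniq) y with x ≟ y
  ... | yes refl = subst (_≤ 1ℤ) (trans (sym (+-identityʳ _)) (cong (λ s → kron x x + s) (sym
                     (listSum-zero (All.map (λ x≢ → kron-≢ (x≢ ∘ sym)) x∉xs))))) (kron≤1 x x)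
  ... | no  x≢y  = subst (_≤ 1ℤ) (trans (sym (+-identityˡ _)) (cong (λ s → s + listSum (λ x → kron x y) xs) (sym
                     (kron-≢ x≢y)))) (multiplicity≤1 uniq y)

  -- Expanding f x as Σ_y `kron x y` · f y and exchanging the sums weights each f y by its
  -- multiplicity in the list, which is at most 1.
  listSum≤cubeSum : ∀ {n} {f : F2 n → ℤ} → (∀ x → 0ℤ ≤ f x) → ∀ {xs} → Unique xs → listSum f xs ≤ cubeSum f
  listSum≤cubeSum {f = f} 0≤f {xs} uniq = subst (_≤ cubeSum f)
    (trans (cubeSum-cong (λ y → sym (listSum-*ʳ (f y) (λ x → kron x y) xs)))
      (trans (cubeSum-listSum (λ x y → kron x y * f y) xs)
        (listSum-cong (λ x → cubeSum-kron x f) xs)))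
    (cubeSum-mono (λ y → subst (listSum (λ x → kron x y) xs * f y ≤_) (*-identityˡ (f y))
      (*-monoʳ-≤-nonNeg (f y) {{ℤ.nonNegative (0≤f y)}} (multiplicity≤1 uniq y))))

  -- Dissociated sets

  xor-interchange : ∀ a b c d → (a xor b) xor (c xor d) ≡ (a xor c) xor (b xor d)
  xor-interchange = CommutativeSemigroupProperties.interchange
    (CommutativeRing.+-commutativeSemigroup BoolP.xor-∧-commutativeRing)

  ⊕-·ˡ : ∀ {n} (S T x : F2 n) → (S ⊕ T) · x ≡ (S · x) xor (T · x)
  ⊕-·ˡ []      []      []      = refl
  ⊕-·ˡ (s ∷ S) (t ∷ T) (b ∷ x) = trans
    (cong₂ _xor_ (BoolP.∧-distribʳ-xor b s t) (⊕-·ˡ S T x))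
    (xor-interchange (s ∧ b) (t ∧ b) (S · x) (T · x))

  𝟎-·ˡ : ∀ {n} (x : F2 n) → 𝟎 · x ≡ false
  𝟎-·ˡ []      = refl
  𝟎-·ˡ (b ∷ x) = 𝟎-·ˡ x

  ∣⊕∣≤ : ∀ {n} (S T : Subset n) → ∣ S ⊕ T ∣ ℕ.≤ ∣ S ∣ ℕ.+ ∣ T ∣
  ∣⊕∣≤ []          []          = ℕ.z≤n
  ∣⊕∣≤ (false ∷ S) (false ∷ T) = ∣⊕∣≤ S T
  ∣⊕∣≤ (false ∷ S) (true  ∷ T) = subst (suc ∣ S ⊕ T ∣ ℕ.≤_) (sym (ℕP.+-suc ∣ S ∣ ∣ T ∣)) (ℕ.s≤s (∣⊕∣≤ S T))
  ∣⊕∣≤ (true  ∷ S) (false ∷ T) = ℕ.s≤s (∣⊕∣≤ S T)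
  ∣⊕∣≤ (true  ∷ S) (true  ∷ T) = ℕP.m≤n⇒m≤1+n
    (subst (∣ S ⊕ T ∣ ℕ.≤_) (sym (ℕP.+-suc ∣ S ∣ ∣ T ∣)) (ℕP.m≤n⇒m≤1+n (∣⊕∣≤ S T)))

  characterSum-≢ : ∀ {n} (r : F2 n) → r ≢ 𝟎 → cubeSum (λ x → sgn (r · x)) ≡ 0ℤ
  characterSum-≢ []          r≢ = contradiction refl r≢
  characterSum-≢ (false ∷ r) r≢ = cong₂ _+_ ih ih
    where ih = characterSum-≢ r (r≢ ∘ cong (false ∷_))
  characterSum-≢ (true  ∷ r) r≢ = trans
    (cong (λ t → s + t) (trans (cubeSum-cong (λ x → sgn-xor true (r · x)))
      (cubeSum-*ˡ -[1+ 0 ] (λ x → sgn (r · x)))))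
    (cancel s)
    where
    s = cubeSum (λ x → sgn (r · x))
    cancel : ∀ s → s + -[1+ 0 ] * s ≡ 0ℤ
    cancel = solve-∀

  module _ {n : ℕ} where

    φ : ∀ {m} → Vec (F2 n) m → F2 n → F2 m
    φ []      x = []
    φ (v ∷ Λ) x = (v · x) ∷ φ Λ x

    subsetSum-· : ∀ {m} (S : Subset m) (Λ : Vec (F2 n) m) x → subsetSum S Λ · x ≡ S · φ Λ x
    subsetSum-· []          []      x = 𝟎-·ˡ x
    subsetSum-· (false ∷ S) (v ∷ Λ) x = trans (⊕-·ˡ 𝟎 (subsetSum S Λ) x)
      (cong₂ _xor_ (𝟎-·ˡ x) (subsetSum-· S Λ x))
    subsetSum-· (true  ∷ S) (v ∷ Λ) x = trans (⊕-·ˡ v (subsetSum S Λ) x)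
      (cong ((v · x) xor_) (subsetSum-· S Λ x))

    module Transfer {m} (Λ : Vec (F2 n) m) (D : ℕ)
      (dissociated : ∀ S → ∣ S ∣ ℕ.≤ D → subsetSum S Λ ≡ 𝟎 → S ≡ 𝟎) where

      -- Equality of the mean of g ∘ φ over F₂^n with the mean of g over F₂^m, cleared of
      -- denominators.
      Balanced : (F2 m → ℤ) → Set
      Balanced g = + (2 ℕ.^ m) * cubeSum (g ∘ φ Λ) ≡ + (2 ℕ.^ n) * cubeSum g

      balanced-cong : ∀ {f g} → (∀ y → f y ≡ g y) → Balanced f → Balanced g
      balanced-cong f≗g = subst₂ _≡_ (cong (+ (2 ℕ.^ m) *_) (cubeSum-cong (f≗g ∘ φ Λ)))
        (cong (+ (2 ℕ.^ n) *_) (cubeSum-cong f≗g))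

      balanced-+ : ∀ {f g} → Balanced f → Balanced g → Balanced (λ y → f y + g y)
      balanced-+ {f} {g} bf bg = trans
        (cong (+ (2 ℕ.^ m) *_) (cubeSum-+ (f ∘ φ Λ) (g ∘ φ Λ)))
        (trans (*-distribˡ-+ (+ (2 ℕ.^ m)) _ _) (trans (cong₂ _+_ bf bg)
          (trans (sym (*-distribˡ-+ (+ (2 ℕ.^ n)) _ _)) (cong (+ (2 ℕ.^ n) *_) (sym (cubeSum-+ f g))))))

      balanced-*ˡ : ∀ {f} c → Balanced f → Balanced (λ y → c * f y)
      balanced-*ˡ {f} c bf = trans
        (cong (+ (2 ℕ.^ m) *_) (cubeSum-*ˡ c (f ∘ φ Λ)))
        (trans (swap (+ (2 ℕ.^ m)) c (cubeSum (f ∘ φ Λ))) (trans (cong (c *_) bf)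
          (trans (swap c (+ (2 ℕ.^ n)) (cubeSum f)) (cong (+ (2 ℕ.^ n) *_) (sym (cubeSum-*ˡ c f))))))
        where
        swap : ∀ a b c → a * (b * c) ≡ b * (a * c)
        swap = solve-∀

      -- Pulling the character S back along φ gives the character of its subset sum. Dissociativity
      -- makes the latter trivial only if S is empty, so both sums vanish together or both count
      -- every point.
      balanced-sgn : ∀ S → ∣ S ∣ ℕ.≤ D → Balanced (λ y → sgn (S · y))
      balanced-sgn S small with S ≟ 𝟎
      ... | yes refl = trans
              (cong (+ (2 ℕ.^ m) *_) (trans (cubeSum-cong (λ x → cong sgn (𝟎-·ˡ (φ Λ x)))) (cubeSum-1 {n})))
              (trans (*-comm (+ (2 ℕ.^ m)) (+ (2 ℕ.^ n)))
                (cong (+ (2 ℕ.^ n) *_) (sym (trans (cubeSum-cong {m} (λ x → cong sgn (𝟎-·ˡ x))) (cubeSum-1 {m})))))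
      ... | no S≢𝟎 = trans
              (cong (+ (2 ℕ.^ m) *_) (trans (cubeSum-cong (λ x → cong sgn (sym (subsetSum-· S Λ x))))
                (characterSum-≢ (subsetSum S Λ) (S≢𝟎 ∘ dissociated S small))))
              (trans (*-zeroʳ (+ (2 ℕ.^ m))) (sym (trans
                (cong (+ (2 ℕ.^ n) *_) (characterSum-≢ S S≢𝟎)) (*-zeroʳ (+ (2 ℕ.^ n))))))

      module _ (σ : F2 m → ℤ) {d} {Ss : List (F2 m)} (sizes : All (λ S → ∣ S ∣ ≡ d) Ss) where

        open Polynomial σ

        -- The factors of the power are expanded one by one, and the character S collects the
        -- product of the terms chosen so far. The size budget is preserved because choosing T
        -- enlarges S by at most d while t drops by one.
        balanced-sgn*poly^ : ∀ t S → ∣ S ∣ ℕ.+ t ℕ.* d ℕ.≤ D → Balanced (λ y → sgn (S · y) * poly Ss y ^ t)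
        balanced-sgn*poly^ zero S small = balanced-cong (λ y → sym (*-identityʳ (sgn (S · y))))
          (balanced-sgn S (subst (ℕ._≤ D) (ℕP.+-identityʳ ∣ S ∣) small))
        balanced-sgn*poly^ (suc t) S small = expand Ss sizes
          where
          expand : ∀ Ts → All (λ T → ∣ T ∣ ≡ d) Ts →
            Balanced (λ y → sgn (S · y) * (poly Ts y * poly Ss y ^ t))
          expand []       []          = balanced-cong (λ y → sym (*-zeroʳ (sgn (S · y))))
            (balanced-*ˡ {λ y → sgn (𝟎 · y)} 0ℤ (balanced-sgn 𝟎 (ℕP.≤-trans (ℕP.≤-reflexive (∣⊥∣≡0 m)) ℕ.z≤n)))
          expand (T ∷ Ts) (refl ∷ sz) = balanced-cong
            (λ y → trans
              (cong (λ s → σ T * (s * poly Ss y ^ t) + sgn (S · y) * (poly Ts y * poly Ss y ^ t))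
                (trans (cong sgn (⊕-·ˡ S T y)) (sgn-xor (S · y) (T · y))))
              (collect (σ T) (sgn (S · y)) (sgn (T · y)) (poly Ts y) (poly Ss y ^ t)))
            (balanced-+
              (balanced-*ˡ (σ T) (balanced-sgn*poly^ t (S ⊕ T) (ℕP.≤-trans
                (ℕP.+-monoˡ-≤ (t ℕ.* d) (∣⊕∣≤ S T))
                (subst (ℕ._≤ D) (sym (ℕP.+-assoc ∣ S ∣ ∣ T ∣ (t ℕ.* d))) small))))
              (expand Ts sz))
            where
            collect : ∀ c s u p q → c * (s * u * q) + s * (p * q) ≡ s * ((c * u + p) * q)
            collect = solve-∀

        balanced-poly^ : ∀ t → t ℕ.* d ℕ.≤ D → Balanced (λ y → poly Ss y ^ t)
        balanced-poly^ t small = balanced-cong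
          (λ y → trans (cong (λ b → sgn b * poly Ss y ^ t) (𝟎-·ˡ y)) (*-identityˡ _))
          (balanced-sgn*poly^ t 𝟎 (subst (λ z → z ℕ.+ t ℕ.* d ℕ.≤ D) (sym (∣⊥∣≡0 m)) small))

  -- Signs, and subsets as relations

  pos-^ : ∀ x n → + (x ℕ.^ n) ≡ (+ x) ^ n
  pos-^ x zero    = refl
  pos-^ x (suc n) = trans (pos-* x (x ℕ.^ n)) (cong (+ x *_) (pos-^ x n))

  -- The value at 0 is 1 and not 0, so that the square is always 1, as `energy-coef` requires.
  unitSign : ℤ → ℤ
  unitSign (+ _)    = 1ℤ
  unitSign -[1+ _ ] = -[1+ 0 ]

  unitSign² : ∀ i → unitSign i * unitSign i ≡ 1ℤ
  unitSign² (+ _)    = refl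
  unitSign² -[1+ _ ] = refl

  unitSign-* : ∀ i → unitSign i * i ≡ + ℤ.∣ i ∣
  unitSign-* (+ n)    = *-identityˡ (+ n)
  unitSign-* -[1+ n ] = -1*i≡-i -[1+ n ]

  asCoef : Bool → Coef
  asCoef false = zer
  asCoef true  = pos

  combo-asCoef : ∀ {n m} (S : Subset m) (Λ : Vec (F2 n) m) → combo (Vec.map asCoef S) Λ ≡ subsetSum S Λ
  combo-asCoef []          []      = refl
  combo-asCoef (false ∷ S) (v ∷ Λ) = cong (𝟎 ⊕_) (combo-asCoef S Λ)
  combo-asCoef (true  ∷ S) (v ∷ Λ) = cong (v ⊕_) (combo-asCoef S Λ)

  weight-asCoef : ∀ {m} (S : Subset m) → weight (Vec.map asCoef S) ≡ ∣ S ∣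
  weight-asCoef []          = refl
  weight-asCoef (false ∷ S) = weight-asCoef S
  weight-asCoef (true  ∷ S) = cong suc (weight-asCoef S)

  asCoef-zer : ∀ {m} (S : Subset m) → (∀ i → lookup (Vec.map asCoef S) i ≡ zer) → S ≡ 𝟎
  asCoef-zer []          _   = refl
  asCoef-zer (false ∷ S) all = cong (false ∷_) (asCoef-zer S (all ∘ Fin.suc))
  asCoef-zer (true  ∷ S) all = contradiction (all Fin.zero) λ ()

  -- A subset is a relation with coefficients 0 and 1 whose weight is its cardinality, so it is one
  -- of the relations excluded by the family.
  inFamily⇒dissociated : ∀ {n m} {P : ℕ → Set} {Λ : Vec (F2 n) m} {D} → (∀ {w} → w ℕ.≤ D → P w) →
    InFamily P Λ → ∀ S → ∣ S ∣ ℕ.≤ D → subsetSum S Λ ≡ 𝟎 → S ≡ 𝟎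
  inFamily⇒dissociated {P = P} {Λ} P-holds fam S small eq = asCoef-zer S
    (fam (Vec.map asCoef S) (subst P (sym (weight-asCoef S)) (P-holds small)) (trans (combo-asCoef S Λ) eq))

  -- Hölder's inequality for Σ_{x ∈ A} P(φ x), with exponent k₂ = 2k = 2 ^ suc s
  module SpectralBound {n m} (A : List (F2 n)) (uniqueA : Unique A) (Λ : Vec (F2 n) m) (d s : ℕ)
    (dissociated : ∀ S → ∣ S ∣ ℕ.≤ 2 ℕ.^ suc s ℕ.* d → subsetSum S Λ ≡ 𝟎 → S ≡ 𝟎)
    (Ss : List (F2 m)) (uniqueSs : Unique Ss) (sizes : All (λ S → ∣ S ∣ ≡ d) Ss) where

    private
      k k₂ : ℕ
      k  = 2 ℕ.^ s
      k₂ = 2 ℕ.^ suc s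
      N M a : ℤ
      N = + (2 ℕ.^ n)
      M = + (2 ℕ.^ m)
      a = + length A
      f̂ : F2 m → ℤ
      f̂ S = fourier A (subsetSum S Λ)

    open Hypercontractivity k (ℕP.m^n>0 2 s) using (w; hypercontractive)
    open Polynomial (unitSign ∘ f̂)

    private
      P : F2 m → ℤ
      P = poly Ss
      V : ℤ
      V = + length Ss * w ^ d

    totalMass : ℤ
    totalMass = listSum (λ S → + ℤ.∣ f̂ S ∣) Ss

    totalMass≡ : totalMass ≡ listSum (P ∘ φ Λ) A
    totalMass≡ = trans
      (listSum-cong (λ S → trans (sym (unitSign-* (f̂ S)))
        (trans (cong (unitSign (f̂ S) *_) (listSum-cong (λ x → cong sgn (subsetSum-· S Λ x)) A))
          (sym (listSum-*ˡ (unitSign (f̂ S)) (λ x → sgn (S · φ Λ x)) A)))) Ss)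
      (listSum-swap (λ S x → unitSign (f̂ S) * sgn (S · φ Λ x)) Ss A)

    cubeMoment : cubeSum (λ y → P y ^ k₂) ≤ M * V ^ k
    cubeMoment = subst₂ _≤_
      (cubeSum-cong (λ y → trans (prod-replicate (λ c → eval c y * eval c y) k (coef Ss))
        (trans (cong (λ e → (e * e) ^ k) (eval-coef Ss y)) (sym (^2^suc (P y) s)))))
      (cong (M *_) (trans (prod-replicate (energy w) k (coef Ss))
        (cong (_^ k) (energy-coef w (unitSign² ∘ f̂) uniqueSs sizes))))
      -- Only now do the k polynomials coincide, giving the 2k-th moment of a single one.
      (hypercontractive m (replicate k (coef Ss)) (ListP.length-replicate k))

    pulledBackMoment : cubeSum (λ x → P (φ Λ x) ^ k₂) ≤ N * V ^ k
    pulledBackMoment = *-cancelˡ-≤-pos _ _ M {{ℤ.positive (ℤ.+<+ (ℕP.m^n>0 2 m))}}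
      (subst₂ _≤_ (sym (Transfer.balanced-poly^ Λ (k₂ ℕ.* d) dissociated (unitSign ∘ f̂) sizes k₂ ℕP.≤-refl))
        (swap N M (V ^ k))
        (*-mono²-≤ {N} (ℤ.+≤+ ℕ.z≤n) cubeMoment))
      where
      swap : ∀ a b c → a * (b * c) ≡ b * (a * c)
      swap = solve-∀

    -- After multiplication by a, both sides are a k-th power times a. Cancelling a and then the
    -- exponent k = 2^s leaves an inequality that is linear in the number of frequencies.
    totalMass²≤ : 1 ℕ.≤ length A → 2 ℕ.^ n ℕ.≤ 2 ℕ.^ (k₂ ℕ.* d) ℕ.* length A →
      totalMass * totalMass ≤ a * a * (+ length Ss * ((+ 4 * w) ^ d))
    totalMass²≤ 1≤a N≤ = ^2^-cancel-≤ s
      (0≤*0≤ (0≤x² a) (0≤*0≤ {+ length Ss} (ℤ.+≤+ ℕ.z≤n) (^-nonneg d (0≤*0≤ {+ 4} (ℤ.+≤+ ℕ.z≤n) 0≤w))))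
      (*-cancelʳ-≤-pos _ _ a {{ℤ.positive (ℤ.+<+ 1≤a)}} (begin
        (totalMass * totalMass) ^ k * a
          ≡⟨ cong (_* a) (^2^suc totalMass s) ⟨
        totalMass ^ k₂ * a
          ≡⟨ cong (λ t → t ^ k₂ * a) totalMass≡ ⟩
        listSum (P ∘ φ Λ) A ^ k₂ * a
          ≤⟨ power-mean (suc s) (P ∘ φ Λ) A ⟩
        a ^ k₂ * listSum (λ x → P (φ Λ x) ^ k₂) A
          ≤⟨ *-mono²-≤ (^-nonneg k₂ 0≤a) (≤-trans (listSum≤cubeSum even-power uniqueA) pulledBackMoment) ⟩
        a ^ k₂ * (N * V ^ k)
          -- The bound 1/δ ≤ 2^(2kd) = (4^d)^k is used as a k-th power, so that it merges with V^k
          -- before the root is taken.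
          ≤⟨ *-mono²-≤ (^-nonneg k₂ 0≤a) (*-monoʳ-≤-nonNeg (V ^ k) {{ℤ.nonNegative 0≤V^k}} N≤′) ⟩
        a ^ k₂ * (((+ 4) ^ d) ^ k * a * V ^ k)
          ≡⟨ cong (_* (((+ 4) ^ d) ^ k * a * V ^ k)) (^2^suc a s) ⟩
        (a * a) ^ k * (((+ 4) ^ d) ^ k * a * V ^ k)
          ≡⟨ move ((a * a) ^ k) (((+ 4) ^ d) ^ k) a (V ^ k) ⟩
        (a * a) ^ k * (((+ 4) ^ d) ^ k * V ^ k) * a
          ≡⟨ cong (λ t → (a * a) ^ k * t * a) (^-distrib-* ((+ 4) ^ d) V k) ⟨
        (a * a) ^ k * ((+ 4) ^ d * V) ^ k * a
          ≡⟨ cong (_* a) (^-distrib-* (a * a) ((+ 4) ^ d * V) k) ⟨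
        (a * a * ((+ 4) ^ d * V)) ^ k * a
          ≡⟨ cong (λ t → (a * a * t) ^ k * a) (trans (swap ((+ 4) ^ d) (+ length Ss) (w ^ d))
               (cong (+ length Ss *_) (sym (^-distrib-* (+ 4) w d)))) ⟩
        (a * a * (+ length Ss * (+ 4 * w) ^ d)) ^ k * a ∎))
      where
      open ≤-Reasoning
      open Hypercontractivity k (ℕP.m^n>0 2 s) using (0≤w)
      0≤a : 0ℤ ≤ a
      0≤a = ℤ.+≤+ ℕ.z≤n
      0≤V^k : 0ℤ ≤ V ^ k
      0≤V^k = ^-nonneg k (0≤*0≤ {+ length Ss} (ℤ.+≤+ ℕ.z≤n) (^-nonneg d 0≤w))
      even-power : ∀ x → 0ℤ ≤ P (φ Λ x) ^ k₂
      even-power x = subst (0ℤ ≤_) (sym (^2^suc (P (φ Λ x)) s)) (^-nonneg k (0≤x² (P (φ Λ x))))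
      swap : ∀ a b c → a * (b * c) ≡ b * (a * c)
      swap = solve-∀
      move : ∀ u c a v → u * (c * a * v) ≡ u * (c * v) * a
      move = solve-∀
      exponent : ((+ 4) ^ d) ^ k ≡ + (2 ℕ.^ (k₂ ℕ.* d))
      exponent = trans (^-*-assoc (+ 4) d k) (trans (^-*-assoc (+ 2) 2 (d ℕ.* k))
        (trans (cong ((+ 2) ^_) (trans (cong (2 ℕ.*_) (ℕP.*-comm d k)) (sym (ℕP.*-assoc 2 k d))))
          (sym (pos-^ 2 (k₂ ℕ.* d)))))
      N≤′ : N ≤ ((+ 4) ^ d) ^ k * a
      N≤′ = subst (N ≤_) (trans (pos-* (2 ℕ.^ (k₂ ℕ.* d)) (length A)) (cong (_* a) (sym exponent))) (ℤ.+≤+ N≤)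

-- Passage from integer inequalities to rational ones

module Rationals where

  open import Data.Rational using (_/_; _+_; _*_; _≤_; _<_; 0ℚ; 1ℚ; 1/_)
  open import Data.Rational.Properties
  open import Data.Rational.Solver using (module +-*-Solver)
  open +-*-Solver using (solve; _:=_; _:*_; _:+_)

  ι : ℤ → ℚ
  ι i = i / 1

  toℚᵘ-ι : ∀ i → ℚ.toℚᵘ (ι i) ℚᵘ.≃ ℚᵘ.mkℚᵘ i 0
  toℚᵘ-ι i = toℚᵘ-fromℚᵘ (ℚᵘ.mkℚᵘ i 0)

  ι-* : ∀ i j → ι (i ℤ.* j) ≡ ι i * ι j
  ι-* i j = toℚᵘ-injective (ℚᵘP.≃-trans (toℚᵘ-ι (i ℤ.* j)) (ℚᵘP.≃-sym
    (ℚᵘP.≃-trans (toℚᵘ-homo-* (ι i) (ι j)) (ℚᵘP.*-cong (toℚᵘ-ι i) (toℚᵘ-ι j)))))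

  ι-+ : ∀ i j → ι (i ℤ.+ j) ≡ ι i + ι j
  ι-+ i j = toℚᵘ-injective (ℚᵘP.≃-trans (toℚᵘ-ι (i ℤ.+ j)) (ℚᵘP.≃-sym
    (ℚᵘP.≃-trans (toℚᵘ-homo-+ (ι i) (ι j)) (ℚᵘP.≃-trans (ℚᵘP.+-cong (toℚᵘ-ι i) (toℚᵘ-ι j))
      (ℚᵘ.*≡* (cross i j))))))
    where
    cross : ∀ i j → (i ℤ.* + 1 ℤ.+ j ℤ.* + 1) ℤ.* + 1 ≡ (i ℤ.+ j) ℤ.* + 1
    cross = solve-∀

  ι-mono : ∀ {i j} → i ℤ.≤ j → ι i ≤ ι j
  ι-mono {i} {j} i≤j = toℚᵘ-cancel-≤ (ℚᵘP.≤-respˡ-≃ (ℚᵘP.≃-sym (toℚᵘ-ι i))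
    (ℚᵘP.≤-respʳ-≃ (ℚᵘP.≃-sym (toℚᵘ-ι j)) (ℚᵘ.*≤* (ℤP.*-monoʳ-≤-nonNeg (+ 1) i≤j))))

  /-*-cancel : ∀ i n .{{_ : ℕ.NonZero n}} → (i / n) * ι (+ n) ≡ ι i
  /-*-cancel i (suc n) = toℚᵘ-injective (ℚᵘP.≃-trans (toℚᵘ-homo-* (i / suc n) (ι (+ suc n)))
    (ℚᵘP.≃-trans (ℚᵘP.*-cong (toℚᵘ-fromℚᵘ (ℚᵘ.mkℚᵘ i n)) (toℚᵘ-ι (+ suc n)))
      (ℚᵘP.≃-trans (ℚᵘ.*≡* (cross i (+ suc n))) (ℚᵘP.≃-sym (toℚᵘ-ι i)))))
    where
    cross : ∀ i d → i ℤ.* d ℤ.* + 1 ≡ i ℤ.* (d ℤ.* + 1)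
    cross = solve-∀

  0≤ι : ∀ n → 0ℚ ≤ ι (+ n)
  0≤ι n = ι-mono {+ 0} {+ n} (ℤ.+≤+ ℕ.z≤n)

  0<ι : ∀ n .{{_ : ℕ.NonZero n}} → ℚ.Positive (ι (+ n))
  0<ι n = normalize-pos n 1

  *-mono-≤ : ∀ {x x′ y y′} → 0ℚ ≤ x → 0ℚ ≤ y → x ≤ x′ → y ≤ y′ → x * y ≤ x′ * y′
  *-mono-≤ {x} {x′} {y} {y′} 0≤x 0≤y x≤x′ y≤y′ = ≤-trans
    (*-monoʳ-≤-nonNeg y {{ℚ.nonNegative 0≤y}} x≤x′)
    (*-monoˡ-≤-nonNeg x′ {{ℚ.nonNegative (≤-trans 0≤x x≤x′)}} y≤y′)

  0≤*0≤ : ∀ {x y} → 0ℚ ≤ x → 0ℚ ≤ y → 0ℚ ≤ x * y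
  0≤*0≤ {x} {y} 0≤x 0≤y = subst (_≤ x * y) (*-zeroʳ x)
    (*-monoˡ-≤-nonNeg x {{ℚ.nonNegative 0≤x}} 0≤y)

  pow-nonneg : ∀ {x} d → 0ℚ ≤ x → 0ℚ ≤ powℚ x d
  pow-nonneg zero    _   = 0≤ι 1
  pow-nonneg (suc d) 0≤x = 0≤*0≤ 0≤x (pow-nonneg d 0≤x)

  pow-mono : ∀ {x y} d → 0ℚ ≤ x → x ≤ y → powℚ x d ≤ powℚ y d
  pow-mono zero    _   _   = ≤-refl
  pow-mono (suc d) 0≤x x≤y = *-mono-≤ 0≤x (pow-nonneg d 0≤x) x≤y (pow-mono d 0≤x x≤y)

  pow-* : ∀ x y d → powℚ (x * y) d ≡ powℚ x d * powℚ y d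
  pow-* x y zero    = refl
  pow-* x y (suc d) = trans (cong (x * y *_) (pow-* x y d))
    (solve 4 (λ x y u v → (x :* y) :* (u :* v) := (x :* u) :* (y :* v)) refl x y (powℚ x d) (powℚ y d))

  pow-ι : ∀ i d → powℚ (ι i) d ≡ ι (i ℤ.^ d)
  pow-ι i zero    = refl
  pow-ι i (suc d) = trans (cong (ι i *_) (pow-ι i d)) (sym (ι-* i (i ℤ.^ d)))

  ι≤quotients : ∀ {c} a b p q .{{_ : ℕ.NonZero b}} .{{_ : ℕ.NonZero q}} →
    c ℕ.* (b ℕ.* q) ℕ.≤ a ℕ.* p → ι (+ c) ≤ ((+ a) / b) * ((+ p) / q)
  ι≤quotients {c} a b p q le = *-cancelʳ-≤-pos (ι (+ b) * ι (+ q))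
    {{pos*pos⇒pos (ι (+ b)) {{0<ι b}} (ι (+ q)) {{0<ι q}}}}
    (subst₂ _≤_
      (trans (cong ι (trans (ℤP.pos-* c (b ℕ.* q)) (cong (+ c ℤ.*_) (ℤP.pos-* b q))))
        (trans (ι-* (+ c) (+ b ℤ.* + q)) (cong (ι (+ c) *_) (ι-* (+ b) (+ q)))))
      (trans (trans (cong ι (ℤP.pos-* a p)) (trans (ι-* (+ a) (+ p))
          (cong₂ _*_ (sym (/-*-cancel (+ a) b)) (sym (/-*-cancel (+ p) q)))))
        (solve 4 (λ x b y q → (x :* b) :* (y :* q) := (x :* y) :* (b :* q)) refl
          ((+ a) / b) (ι (+ b)) ((+ p) / q) (ι (+ q))))
      (ι-mono (ℤ.+≤+ le)))

  -- Trades k for (p/q)/d when kd ≤ p/q; this is how the dyadic scale is replaced by a candidate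
  -- value of the logarithm.
  pow-ι≤quotients : ∀ {c a k} d p q .{{_ : ℕ.NonZero d}} .{{_ : ℕ.NonZero q}} → c ℕ.≤ a → k ℕ.* d ℕ.* q ℕ.≤ p →
    ι ((+ (c ℕ.* k)) ℤ.^ d) ≤ powℚ ((+ a) / d) d * powℚ ((+ p) / q) d
  pow-ι≤quotients {c} {a} {k} d p q c≤a kdq≤p = subst₂ _≤_
    (pow-ι (+ (c ℕ.* k)) d) (pow-* ((+ a) / d) ((+ p) / q) d)
    (pow-mono d (0≤ι (c ℕ.* k)) (ι≤quotients {c ℕ.* k} a d p q
      (ℕP.≤-trans (ℕP.≤-reflexive (trans (ℕP.*-assoc c k (d ℕ.* q)) (cong (c ℕ.*_) (sym (ℕP.*-assoc k d q)))))
        (ℕP.*-mono-≤ c≤a kdq≤p))))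

  sum-lower-bound : ∀ {X : Set} (c : ℚ) (f : X → ℤ) xs → All (λ x → c ≤ ι (f x)) xs →
    c * ι (+ length xs) ≤ ι (Moments.listSum f xs)
  sum-lower-bound c f []       []         = ≤-reflexive (*-zeroʳ c)
  sum-lower-bound c f (x ∷ xs) (c≤ ∷ c≤s) = subst₂ _≤_
    (trans (solve 2 (λ c l → c :+ c :* l := c :* (con 1ℚ :+ l)) refl c (ι (+ length xs)))
      (cong (c *_) (sym (ι-+ (+ 1) (+ length xs)))))
    (sym (ι-+ (f x) (Moments.listSum f xs)))
    (+-mono-≤ c≤ (sum-lower-bound c f xs c≤s))
    where open +-*-Solver using (con)

  -- Squaring the lower bound and inserting a = DN gives (αNr)² ≤ (DN)² r W. Cancelling N² r and
  -- dividing by α² leaves one power of r.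
  divide-out : ∀ (α D : ℚ) .{{_ : ℚ.Positive α}} (N a r : ℕ) (B : ℤ) (W : ℤ) .{{_ : ℕ.NonZero N}} →
    ι (+ a) ≡ D * ι (+ N) → 0ℚ ≤ D → ℤ.+ 0 ℤ.≤ W → α * ι (+ N) * ι (+ r) ≤ ι B →
    B ℤ.* B ℤ.≤ + a ℤ.* + a ℤ.* (+ r ℤ.* W) →
    ι (+ r) ≤ powℚ (D * (1/ α) {{pos⇒nonZero α}}) 2 * ι W
  -- With r = 0 the factor N² r cannot be cancelled, but the right-hand side is nonnegative.
  divide-out α D N a zero B W a≡ 0≤D 0≤W low up = 0≤*0≤ (pow-nonneg 2 (0≤*0≤ 0≤D 0≤1/α)) (ι-mono 0≤W)
    where
    0≤1/α = <⇒≤ (positive⁻¹ ((1/ α) {{pos⇒nonZero α}}) {{1/pos⇒pos α}})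
  divide-out α D N a r@(suc _) B W a≡ 0≤D 0≤W low up = subst₂ _≤_
    (trans (solve 3 (λ β α r → (β :* β) :* (α :* α :* r) := (α :* β) :* (α :* β) :* r) refl β α (ι (+ r)))
      (trans (cong (λ t → t * t * ι (+ r)) (*-inverseʳ α {{pos⇒nonZero α}})) (*-identityˡ _)))
    (solve 3 (λ β D W → (β :* β) :* (D :* D :* W) := ((D :* β) :* ((D :* β) :* con 1ℚ)) :* W) refl β D (ι W))
    (*-monoˡ-≤-nonNeg (β * β) {{ℚ.nonNegative (0≤*0≤ 0≤β 0≤β)}}
      (*-cancelˡ-≤-pos c {{c>0}} (subst₂ _≤_
        (solve 3 (λ α N r → (α :* N :* r) :* (α :* N :* r) := N :* N :* r :* (α :* α :* r)) refl α (ι (+ N)) (ι (+ r)))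
        (trans (cong (λ x → x * x * (ι (+ r) * ι W)) a≡)
          (solve 4 (λ D N r W → (D :* N) :* (D :* N) :* (r :* W) := N :* N :* r :* (D :* D :* W))
            refl D (ι (+ N)) (ι (+ r)) (ι W)))
        (≤-trans (*-mono-≤ 0≤t 0≤t low low)
          (subst₂ _≤_ (ι-* B B)
            (trans (ι-* (+ a ℤ.* + a) (+ r ℤ.* W)) (cong₂ _*_ (ι-* (+ a) (+ a)) (ι-* (+ r) W)))
            (ι-mono up))))))
    where
    open +-*-Solver using (con)
    β = (1/ α) {{pos⇒nonZero α}}
    0≤β = <⇒≤ (positive⁻¹ β {{1/pos⇒pos α}})
    0≤t = 0≤*0≤ (0≤*0≤ (<⇒≤ (positive⁻¹ α)) (0≤ι N)) (0≤ι r)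
    c = ι (+ N) * ι (+ N) * ι (+ r)
    c>0 : ℚ.Positive c
    c>0 = pos*pos⇒pos (ι (+ N) * ι (+ N)) {{pos*pos⇒pos (ι (+ N)) {{0<ι N}} (ι (+ N)) {{0<ι N}}}} (ι (+ r)) {{0<ι r}}

open import Data.Nat using (_^_; _*_; _≤_)
open import Data.Rational using (_/_)

-- Choice of the exponent k in terms of log(1/δ)

module Exponents where

  open ℕP

  last-holding : ∀ {P : ℕ → Set} → (∀ i → Dec (P i)) → P 0 → ∀ n → ¬ P n → ∃ λ i → P i × ¬ P (suc i)
  last-holding P? p₀ zero    ¬pₙ = contradiction p₀ ¬pₙ
  last-holding P? p₀ (suc n) ¬pₙ with P? n
  ... | yes pₙ = n , pₙ , ¬pₙ
  ... | no ¬p  = last-holding P? p₀ n ¬p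

  n<2^n : ∀ n → n ℕ.< 2 ^ n
  n<2^n zero    = ℕ.s≤s ℕ.z≤n
  n<2^n (suc n) = subst (2 ℕ.+ n ≤_) (cong (2 ^ n ℕ.+_) (sym (+-identityʳ (2 ^ n))))
    (+-mono-≤ (m^n>0 2 n) (n<2^n n))

  ^-distribʳ-* : ∀ x y n → (x * y) ^ n ≡ x ^ n * y ^ n
  ^-distribʳ-* x y zero    = refl
  ^-distribʳ-* x y (suc n) = trans (cong (x * y *_) (^-distribʳ-* x y n))
    (CommutativeSemigroupProperties.interchange *-commutativeSemigroup x y (x ^ n) (y ^ n))

  -- The first inequality says that the integer t is at most log(1/δ); its q-th power compares t
  -- with every fraction p/q ≤ t.
  logGE-scale : ∀ {n} (A : List (F2 n)) {t p} q → 2 ^ t * length A ≤ 2 ^ n → p ≤ t * q → LogGE A p q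
  logGE-scale {n} A {t} {p} q le p≤ = ≤-trans
    (*-monoˡ-≤ (length A ^ q) (^-monoʳ-≤ 2 p≤))
    (subst (_≤ (2 ^ n) ^ q)
      (trans (^-distribʳ-* (2 ^ t) (length A) q) (cong (_* length A ^ q) (^-*-assoc 2 t q)))
      (^-monoˡ-≤ q le))

  -- k = 2 ^ s is the largest power of two with k d ≤ log₂ (1/δ).
  dyadic-scale : ∀ {n} (A : List (F2 n)) {d} → 1 ≤ d → 1 ≤ length A → LogGE A (4 * d) 1 →
    ∃ λ s → 2 ^ (2 ^ s * d) * length A ≤ 2 ^ n × 2 ^ n ≤ 2 ^ (2 ^ suc s * d) * length A
  dyadic-scale {n} A {d} 1≤d 1≤a large with last-holding (λ s → 2 ^ (2 ^ s * d) * length A ℕ.≤? 2 ^ n) start n end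
    where
    -- At k = 1 the requirement is d ≤ log(1/δ), which 4d ≤ log(1/δ) supplies.
    start : 2 ^ (2 ^ 0 * d) * length A ≤ 2 ^ n
    start = ≤-trans (*-monoˡ-≤ (length A) (^-monoʳ-≤ 2 (*-monoˡ-≤ d {1} {4} (ℕ.s≤s ℕ.z≤n))))
      (subst₂ (λ x y → 2 ^ (4 * d) * x ≤ y) (*-identityʳ (length A)) (*-identityʳ (2 ^ n)) large)
    -- The search stops by s = n: log(1/δ) ≤ n since A is nonempty, whereas n < 2^n ≤ 2^n d.
    end : ¬ (2 ^ (2 ^ n * d) * length A ≤ 2 ^ n)
    end le = <⇒≱ (^-monoʳ-< 2 (ℕ.s≤s (ℕ.s≤s ℕ.z≤n)) (≤-trans (n<2^n n) (m≤m*n (2 ^ n) d {{ℕ.>-nonZero 1≤d}})))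
      (≤-trans (m≤m*n (2 ^ (2 ^ n * d)) (length A) {{ℕ.>-nonZero 1≤a}}) le)
  ... | s , holds , fails = s , holds , <⇒≤ (≰⇒> fails)

  4w≤36k : ∀ k → 1 ≤ k → + 4 ℤ.* (+ 1 ℤ.+ + 4 ℤ.* (+ 2 ℤ.* + k)) ℤ.≤ + (36 * k)
  4w≤36k k 1≤k = Moments.≤-from-gap (trans (ℤP.pos-* 36 k) (gap (+ k)))
    (Moments.0≤*0≤ {+ 4} (ℤ.+≤+ ℕ.z≤n) (ℤP.i≤j⇒0≤j-i (ℤ.+≤+ 1≤k)))
    where
    gap : ∀ k → + 36 ℤ.* k ≡ + 4 ℤ.* (+ 1 ℤ.+ + 4 ℤ.* (+ 2 ℤ.* k)) ℤ.+ + 4 ℤ.* (k ℤ.- + 1)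
    gap = solve-∀

-- The large spectrum inside the d-fold sums

Indexed : ∀ {n m} → ℕ → (F2 n → Set) → Vec (F2 n) m → List (F2 n) → Set
Indexed d Q Λ R = ∃ λ Ss →
  map (λ S → subsetSum S Λ) Ss ≡ R × All (λ S → ∣ S ∣ ≡ d) Ss × All (λ S → Q (subsetSum S Λ)) Ss

-- Fixes one index set per frequency. Distinct frequencies then have distinct index sets, which is
-- the uniqueness that the energy computation needs.
index : ∀ {n m d} (Q : F2 n → Set) (Λ : Vec (F2 n) m) {R} → All (λ r → InDotSum d Λ r × Q r) R → Indexed d Q Λ R
index Q Λ []                              = [] , refl , [] , []
index Q Λ (((S , size , refl) , q) ∷ all) with index Q Λ all
... | Ss , refl , sizes , qs = S ∷ Ss , refl , size ∷ sizes , q ∷ qs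

module SpectrumBound {n} (A : List (F2 n)) (α : ℚ) .{{_ : ℚ.Positive α}} (α≤δ : α ℚ.≤ δ A) where

  open Rationals

  instance
    2^n≢0 : ℕ.NonZero (2 ^ n)
    2^n≢0 = ℕP.m^n≢0 2 n

  0≤δ : ℚ.0ℚ ℚ.≤ δ A
  0≤δ = ℚP.≤-trans (ℚP.<⇒≤ (ℚP.positive⁻¹ α)) α≤δ

  ∣A∣≡δN : ι (+ length A) ≡ δ A ℚ.* ι (+ (2 ^ n))
  ∣A∣≡δN = sym (/-*-cancel (+ length A) (2 ^ n))

  1≤∣A∣ : 1 ≤ length A
  1≤∣A∣ = ℕP.n≢0⇒n>0 λ ∣A∣≡0 → ℚP.<-irrefl (trans (cong (λ l → ι (+ l)) (sym ∣A∣≡0)) ∣A∣≡δN)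
    (ℚP.positive⁻¹ (δ A ℚ.* ι (+ (2 ^ n))) {{ℚP.pos*pos⇒pos (δ A)
      {{ℚ.positive (ℚP.<-≤-trans (ℚP.positive⁻¹ α) α≤δ)}} (ι (+ (2 ^ n))) {{0<ι (2 ^ n)}}}})

  α⁻¹ ratio² : ℚ
  α⁻¹    = (ℚ.1/ α) {{ℚP.pos⇒nonZero α}}
  ratio² = powℚ (δ A ℚ.* α⁻¹) 2

  0≤ratio² : ℚ.0ℚ ℚ.≤ ratio²
  0≤ratio² = pow-nonneg 2 (0≤*0≤ 0≤δ (ℚP.<⇒≤ (ℚP.positive⁻¹ α⁻¹ {{ℚP.1/pos⇒pos α}})))

  Large : F2 n → Set
  Large r = α ℚ.* ((+ (2 ^ n)) / 1) ℚ.≤ (+ ℤ.∣ fourier A r ∣) / 1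

  ∣spectrum∣≤ : ∀ {m} → Unique A → (Λ : Vec (F2 n) m) → InFamily (λ w → LogGE A w 2) Λ → ∀ d s →
    2 ^ (2 ^ s * d) * length A ≤ 2 ^ n → 2 ^ n ≤ 2 ^ (2 ^ suc s * d) * length A → ∀ {R} → Unique R →
    Indexed d Large Λ R → ι (+ length R) ℚ.≤ ratio² ℚ.* ι ((+ (36 * 2 ^ s)) ℤ.^ d)
  ∣spectrum∣≤ uniqueA Λ inFamily d s log≥ log≤ uniqueR (Ss , refl , sizes , large) = subst
    (λ l → ι (+ l) ℚ.≤ ratio² ℚ.* ι W)
    (sym (ListP.length-map (λ S → subsetSum S Λ) Ss))
    (divide-out α (δ A) (2 ^ n) (length A) (length Ss) totalMass W ∣A∣≡δN 0≤δ
      (Moments.^-nonneg d (ℤ.+≤+ ℕ.z≤n)) (sum-lower-bound (α ℚ.* ι (+ (2 ^ n))) f Ss large)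
      (ℤP.≤-trans (totalMass²≤ 1≤∣A∣ log≤)
        (Moments.*-mono²-≤ (Moments.0≤x² (+ length A)) (Moments.*-mono²-≤ {+ length Ss} (ℤ.+≤+ ℕ.z≤n)
          (Moments.^-mono d (Moments.0≤*0≤ {+ 4} (ℤ.+≤+ ℕ.z≤n) (Moments.Hypercontractivity.0≤w k 1≤k))
            (Exponents.4w≤36k k 1≤k))))))
    where
    k = 2 ^ s
    1≤k = ℕP.m^n>0 2 s
    W = (+ (36 * k)) ℤ.^ d
    f = λ S → + ℤ.∣ fourier A (subsetSum S Λ) ∣
    open Moments.SpectralBound A uniqueA Λ d s
      -- `LogGE A w 2` reads w ≤ 2 log(1/δ), so every weight up to 2kd is covered by kd ≤ log(1/δ).
      (Moments.inFamily⇒dissociated {P = λ w → LogGE A w 2}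
        (λ {w} w≤ → Exponents.logGE-scale A {k * d} 2 log≥
          (subst (w ≤_) (trans (ℕP.*-assoc 2 k d) (ℕP.*-comm 2 (k * d))) w≤)) inFamily)
      Ss (UniqueP.map⁻ uniqueR) sizes

-- The real bound is tested on rationals: if |R| exceeded K·log(1/δ)^d, with K = `boundK`, some p/q
-- slightly above log(1/δ) would still satisfy K·(p/q)^d < |R|, against the conclusion.
theorem12 : ∀ {n m} (A : List (F2 n)) → Unique A
    → (α : ℚ) → .{{_ : ℚ.Positive α}} → α ℚ.≤ δ A → δ A ℚ.≤ (+ 1) / 4
    → (Λ : Vec (F2 n) m) → (∀ i j → lookup Λ i ≡ lookup Λ j → i ≡ j)
    → InFamily (λ w → LogGE A w 2) Λ
    → (d : ℕ) → (1≤d : 1 ≤ d) → LogGE A (4 * d) 1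
    → (R : List (F2 n)) → Unique R
    → All (λ r → InDotSum d Λ r × (α ℚ.* ((+ (2 ^ n)) / 1) ℚ.≤ (+ ℤ.∣ fourier A r ∣) / 1)) R
    → (p q : ℕ) → .{{_ : ℕ.NonZero q}}
    → boundK (δ A) α d 1≤d ℚ.* powℚ ((+ p) / q) d ℚ.< (+ length R) / 1
    → LogGE A p q
theorem12 {n} A uniqueA α α≤δ _ Λ _ inFamily d 1≤d 4d≤log R uniqueR spectrum p q exceeds =
  conclude (Exponents.dyadic-scale A 1≤d 1≤∣A∣ 4d≤log)
  where
  open Rationals
  open SpectrumBound A α α≤δ
  instance
    d≢0 : ℕ.NonZero d
    d≢0 = ℕ.>-nonZero 1≤d

  conclude : (∃ λ s → 2 ^ (2 ^ s * d) * length A ≤ 2 ^ n × 2 ^ n ≤ 2 ^ (2 ^ suc s * d) * length A) → LogGE A p q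
  conclude (s , log≥ , log≤) = cases (ℕP.≤-<-connex p (2 ^ s * d * q))
    where
    -- The integer kd separates the cases. A fraction p/q ≤ kd is below log(1/δ) by the choice of k;
    -- for p/q > kd the bound with (36k)^d already rules out the assumed excess of |R|.
    cases : p ≤ 2 ^ s * d * q ⊎ 2 ^ s * d * q ℕ.< p → LogGE A p q
    cases (inj₁ p≤) = Exponents.logGE-scale A {2 ^ s * d} q log≥ p≤
    cases (inj₂ p>) = contradiction
      (ℚP.<-≤-trans exceeds (ℚP.≤-trans
        (∣spectrum∣≤ uniqueA Λ inFamily d s log≥ log≤ uniqueR (index Large Λ spectrum))
        (ℚP.≤-trans
          (ℚP.*-monoˡ-≤-nonNeg ratio² {{ℚ.nonNegative 0≤ratio²}}
            (pow-ι≤quotients {36} {2 ^ 12} {2 ^ s} d p q (ℕP.≤ᵇ⇒≤ 36 (2 ^ 12) _) (ℕP.<⇒≤ p>)))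
          (ℚP.≤-reflexive (sym (ℚP.*-assoc ratio² (powℚ ((+ (2 ^ 12)) / d) d) (powℚ ((+ p) / q) d)))))))
      (ℚP.<-irrefl refl)
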